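{- A game $\mathcal{M}\subseteq\mathbb{N}_0$ (dimension $d=1$) is reflexive if and only if $\mathcal{M}=\mathcal{M}_k$ for some $k\in\mathbb{N}_0$, where $\mathcal{M}_0=\varnothing$ and, for $k\ge1$, with $p_k=3k-1$, $$\mathcal{M}_k=\{\,ip_k+j:\ i\in\mathbb{N}_0,\ k\le j\le 2k-1\,\}.$$
   Context: A one-heap game is a set $\mathcal{M}\subseteq\mathbb{N}_0$ of moves; from position $x\in\mathbb{N}_0$ one may move to $y\in\mathbb{N}_0$ iff $x-y\in\mathcal{M}$. Misère play: a player who cannot move wins. If $0\in\mathcal{M}$, $P(\mathcal{M})=\varnothing$. Otherwise: a position is an N-position if it has no option or some option is a P-position; otherwise it is a P-position; $P(\mathcal{M})$ denotes the set of P-positions. The game $\mathcal{M}$ is reflexive if $P(\mathcal{M})=\mathcal{M}$. -}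

module Defs where

open import Data.Nat using (ℕ; zero; suc; _+_; _*_; _∸_; _≤_; _<_)
open import Data.Nat.Properties using (m<m+n; n≢0⇒n>0)
open import Data.Nat.Induction using (<-wellFounded)
open import Data.Product using (Σ-syntax; ∃-syntax; _×_; _,_)
open import Data.Sum using (_⊎_; inj₁; inj₂)
open import Function using (_∘_; _⇔_; mk⇔)
open import Induction.WellFounded using (Acc; acc)
open import Level using (0ℓ)
open import Relation.Binary.PropositionalEquality using (_≡_; refl)
open import Relation.Nullary using (¬_)
open import Relation.Unary using (Pred; _∈_; _∉_; ∅; _≐_)

Game : Set₁
Game = Pred ℕ 0ℓ

module _ (M : Game) where

  -- x − y ∈ M, the difference being taken in ℤ (so that y ≤ x).
  Option : ℕ → ℕ → Set
  Option x y = ∃[ m ] m ∈ M × y + m ≡ x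

  -- Misère play. The bound y < x only serves the recursion: every option
  -- is smaller when 0 ∉ M, and P-Positions is empty when 0 ∈ M.
  -- NPosition-⇔ below is the recursion without this bound.
  NPositionAcc : ∀ x → Acc _<_ x → Set
  NPositionAcc x (acc rs) =
    (∀ y → ¬ Option x y) ⊎
    (∃[ y ] Σ[ y<x ∈ y < x ] Option x y × ¬ NPositionAcc y (rs y<x))

  NPosition : ℕ → Set
  NPosition x = NPositionAcc x (<-wellFounded x)

  P-Positions : Pred ℕ 0ℓ
  P-Positions x = 0 ∉ M × ¬ NPosition x

  IsReflexive : Set
  IsReflexive = P-Positions ≐ M

  Option⇒< : 0 ∉ M → ∀ {x y} → Option x y → y < x
  Option⇒< 0∉M {y = y} (m , m∈M , refl) =
    m<m+n y (n≢0⇒n>0 λ { refl → 0∉M m∈M })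

  NPositionAcc-irrelevant : ∀ {x} (a b : Acc _<_ x) →
                            NPositionAcc x a → NPositionAcc x b
  NPositionAcc-irrelevant (acc _) (acc _) (inj₁ terminal) = inj₁ terminal
  NPositionAcc-irrelevant (acc rs) (acc rs′) (inj₂ (y , y<x , o , ¬n)) =
    inj₂ (y , y<x , o , ¬n ∘ NPositionAcc-irrelevant (rs′ y<x) (rs y<x))

  NPosition-⇔ : 0 ∉ M → ∀ x →
    NPosition x ⇔ ((∀ y → ¬ Option x y) ⊎ (∃[ y ] Option x y × y ∈ P-Positions))
  NPosition-⇔ 0∉M x = mk⇔ (to (<-wellFounded x)) (from (<-wellFounded x))
    where
    RHS : Set
    RHS = (∀ y → ¬ Option x y) ⊎ (∃[ y ] Option x y × y ∈ P-Positions)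

    to : (a : Acc _<_ x) → NPositionAcc x a → RHS
    to (acc rs) (inj₁ terminal) = inj₁ terminal
    to (acc rs) (inj₂ (y , y<x , o , ¬n)) =
      inj₂ (y , o , 0∉M ,
            ¬n ∘ NPositionAcc-irrelevant (<-wellFounded y) (rs y<x))

    from : (a : Acc _<_ x) → RHS → NPositionAcc x a
    from (acc rs) (inj₁ terminal) = inj₁ terminal
    from (acc rs) (inj₂ (y , o , _ , ¬n)) =
      let y<x = Option⇒< 0∉M o in
      inj₂ (y , y<x , o ,
            ¬n ∘ NPositionAcc-irrelevant (rs y<x) (<-wellFounded y))

-- Only used for k ≥ 1, where the truncated subtraction is exact.
p : ℕ → ℕ
p k = 3 * k ∸ 1

𝓜 : ℕ → Game
𝓜 zero      = ∅
𝓜 k@(suc _) = λ x →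
  ∃[ i ] ∃[ j ] k ≤ j × j ≤ 2 * k ∸ 1 × x ≡ i * p k + j

{-# OPTIONS --safe #-}

-- Let k be the least move of a nonempty game M with 0 ∉ M. A position has an
-- option iff it is at least k, so M is reflexive iff
--   M = { x ≥ k : x ∉ M + M }.
-- Both summands of x ∈ M + M are smaller than x, so by induction this equation
-- has exactly one solution for each k ≥ 1. That solution is 𝓜 k: modulo
-- 3k − 1 its residues are k, …, 2k − 1, and the sums of two of these are
-- precisely the remaining residues.
module Submission where

open import Defs
open import Axiom.ExcludedMiddle using (ExcludedMiddle)
open import Data.Empty using (⊥-elim)
open import Data.Nat using (ℕ; zero; suc; _+_; _*_; _∸_; _≤_; _<_; z≤n; s≤s; s≤s⁻¹)
open import Data.Nat.DivMod using (_/_; _%_; m≡m%n+[m/n]*n; m%n<n; [m+kn]%n≡m%n; m<n⇒m%n≡m)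
open import Data.Nat.Induction using (<-rec)
open import Data.Nat.Properties
open import Data.Nat.Tactic.RingSolver using (solve-∀)
open import Data.Product using (∃-syntax; _×_; _,_; proj₁; proj₂)
open import Data.Sum using (inj₁; inj₂; [_,_]′)
open import Function using (_⇔_; mk⇔; _∘_; Equivalence)
open import Level using (0ℓ)
open import Relation.Binary.PropositionalEquality
  using (_≡_; refl; sym; trans; cong; subst; module ≡-Reasoning)
open import Relation.Nullary using (¬_; yes; no; contradiction)
open import Relation.Unary using (Pred; _∈_; _∉_; ∅; _≐_)
open import Relation.Unary.Properties using (≐-sym)

open Equivalence using (to; from)

-- This is the sumset of `M` and `Q`, since an option `y` of `x` satisfies `y + m ≡ x` for some move
-- `m`.
HasOptionIn : Game → Pred ℕ 0ℓ → Pred ℕ 0ℓ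
HasOptionIn M Q x = ∃[ y ] Option M x y × y ∈ Q

AtLeastAvoiding : ℕ → Pred ℕ 0ℓ → Pred ℕ 0ℓ
AtLeastAvoiding k S x = k ≤ x × x ∉ S

SelfAvoiding : ℕ → Game → Set
SelfAvoiding k M = M ≐ AtLeastAvoiding k (HasOptionIn M M)

-- Strong induction on `x`: the two equations reduce membership at `x` to `S` and `S′` there, and
-- `step` compares these from agreement below `x`.
≐-avoiding : ∀ {k} {Q Q′ S S′ : Pred ℕ 0ℓ} →
             Q ≐ AtLeastAvoiding k S → Q′ ≐ AtLeastAvoiding k S′ →
             (∀ x → (∀ {y} → y < x → y ∈ Q ⇔ y ∈ Q′) → x ∈ S ⇔ x ∈ S′) →
             Q ≐ Q′
≐-avoiding {Q = Q} {Q′} (Q⊆ , ⊆Q) (Q′⊆ , ⊆Q′) step =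
  (λ {x} → to (agree x)) , (λ {x} → from (agree x))
  where
  agree : ∀ x → x ∈ Q ⇔ x ∈ Q′
  agree = <-rec _ λ x ih → mk⇔
    (λ q → let k≤x , x∉S = Q⊆ q in ⊆Q′ (k≤x , x∉S ∘ from (step x ih)))
    (λ q → let k≤x , x∉S = Q′⊆ q in ⊆Q (k≤x , x∉S ∘ to (step x ih)))

SelfAvoiding-resp-≐ : ∀ {k} {M N : Game} → M ≐ N → SelfAvoiding k M → SelfAvoiding k N
SelfAvoiding-resp-≐ (M⊆N , N⊆M) (M⊆ , ⊆M) =
  (λ n → let k≤x , x∉ = M⊆ (N⊆M n) in
     k≤x , λ (y , (m , m∈ , eq) , y∈) → x∉ (y , (m , N⊆M m∈ , eq) , N⊆M y∈)) ,
  (λ (k≤x , x∉) → M⊆N (⊆M (k≤x ,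
     λ (y , (m , m∈ , eq) , y∈) → x∉ (y , (m , M⊆N m∈ , eq) , M⊆N y∈))))

-- All elements are positive, so both summands of `x` lie strictly below `x` and the induction
-- hypothesis applies to each.
SelfAvoiding-unique : ∀ {n} {M N : Game} →
                      SelfAvoiding (suc n) M → SelfAvoiding (suc n) N → M ≐ N
SelfAvoiding-unique M-avoids@(M⊆ , _) N-avoids@(N⊆ , _) =
  ≐-avoiding M-avoids N-avoids λ x ih → mk⇔
    (λ (y , (m , m∈ , eq) , y∈) →
       let y< , m< = summands-< (proj₁ (M⊆ y∈)) (proj₁ (M⊆ m∈)) eq in
       y , (m , to (ih m<) m∈ , eq) , to (ih y<) y∈)
    (λ (y , (m , m∈ , eq) , y∈) →
       let y< , m< = summands-< (proj₁ (N⊆ y∈)) (proj₁ (N⊆ m∈)) eq in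
       y , (m , from (ih m<) m∈ , eq) , from (ih y<) y∈)
  where
  summands-< : ∀ {n y m x} → suc n ≤ y → suc n ≤ m → y + m ≡ x → y < x × m < x
  summands-< {y = suc y} {m = suc m} (s≤s _) (s≤s _) refl =
    m<m+n (suc y) (s≤s z≤n) , m<n+m (suc m) (s≤s z≤n)

module _ {M : Game} {k : ℕ} (0∉M : 0 ∉ M) (k∈M : k ∈ M)
         (k-least : ∀ {m} → m ∈ M → k ≤ m) where

  -- Below the least move every position is terminal; from `k` on, `x ∸ k` is an option. This turns
  -- the negated N-position clauses into the two conditions.
  P-avoids : P-Positions M ≐ AtLeastAvoiding k (HasOptionIn M (P-Positions M))
  P-avoids =
    (λ {x} (_ , ¬N) →
       ≮⇒≥ (λ x<k → ¬N (from (NPosition-⇔ M 0∉M x) (inj₁ (terminal x<k)))) ,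
       ¬N ∘ from (NPosition-⇔ M 0∉M x) ∘ inj₂) ,
    (λ {x} (k≤x , x∉) →
       0∉M ,
       [ (λ none → none (x ∸ k) (k , k∈M , m∸n+n≡m k≤x)) , x∉ ]′
         ∘ to (NPosition-⇔ M 0∉M x))
    where
    terminal : ∀ {x} → x < k → ∀ y → ¬ Option M x y
    terminal x<k y (m , m∈M , refl) =
      <⇒≱ x<k (≤-trans (k-least m∈M) (m≤n+m m y))

  IsReflexive⇒SelfAvoiding : IsReflexive M → SelfAvoiding k M
  IsReflexive⇒SelfAvoiding (P⊆M , M⊆P) =
    (λ m → let k≤x , x∉ = proj₁ P-avoids (M⊆P m) in
       k≤x , λ (y , o , y∈) → x∉ (y , o , M⊆P y∈)) ,
    (λ (k≤x , x∉) → P⊆M (proj₂ P-avoids (k≤x ,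
       λ (y , o , y∈) → x∉ (y , o , P⊆M y∈))))

  -- The moves come from `M` in both equations; only the set containing the option differs, and
  -- options are smaller than `x`.
  SelfAvoiding⇒IsReflexive : SelfAvoiding k M → IsReflexive M
  SelfAvoiding⇒IsReflexive avoids = ≐-avoiding P-avoids avoids λ x ih → mk⇔
    (λ (y , o , y∈) → y , o , to (ih (Option⇒< M 0∉M o)) y∈)
    (λ (y , o , y∈) → y , o , from (ih (Option⇒< M 0∉M o)) y∈)

module _ (n : ℕ) where

  private
    -- `q` is 3k - 1 without truncated subtraction, and reduces to a successor, so division by it is
    -- allowed.
    k q : ℕ
    k = suc n
    q = k + (k + n)

  p-suc : p k ≡ q
  p-suc = lemma n
    where
    lemma : ∀ n → n + (suc n + (suc n + 0)) ≡ suc n + (suc n + n)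
    lemma = solve-∀

  2k∸1≡k+n : 2 * k ∸ 1 ≡ k + n
  2k∸1≡k+n = lemma n
    where
    lemma : ∀ n → n + (suc n + 0) ≡ suc n + n
    lemma = solve-∀

  ∈𝓜 : ∀ i {w} → w ≤ n → i * q + (k + w) ∈ 𝓜 k
  ∈𝓜 i {w} w≤n =
    i , k + w , m≤m+n k w ,
    subst (k + w ≤_) (sym 2k∸1≡k+n) (+-monoʳ-≤ k w≤n) ,
    cong (λ d → i * d + (k + w)) (sym p-suc)

  𝓜∋ : ∀ {x} → x ∈ 𝓜 k → ∃[ i ] ∃[ w ] w ≤ n × x ≡ i * q + (k + w)
  𝓜∋ (i , j , k≤j , j≤ , refl) with m≤n⇒∃[o]m+o≡n k≤j
  ... | w , refl =
    i , w , +-cancelˡ-≤ k w n (subst (k + w ≤_) 2k∸1≡k+n j≤) ,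
    cong (λ d → i * d + (k + w)) p-suc

  k≤∈𝓜 : ∀ {x} → x ∈ 𝓜 k → k ≤ x
  k≤∈𝓜 (i , j , k≤j , _ , refl) = ≤-trans k≤j (m≤n+m j (i * p k))

  remainder-unique : ∀ {r s} i j → r < q → s < q → r + i * q ≡ s + j * q → r ≡ s
  remainder-unique {r} {s} i j r<q s<q eq = begin
    r                ≡⟨ m<n⇒m%n≡m r<q ⟨
    r % q            ≡⟨ [m+kn]%n≡m%n r i q ⟨
    (r + i * q) % q  ≡⟨ cong (_% q) eq ⟩
    (s + j * q) % q  ≡⟨ [m+kn]%n≡m%n s j q ⟩
    s % q            ≡⟨ m<n⇒m%n≡m s<q ⟩
    s                ∎
    where open ≡-Reasoning

  -- A sum has the form 2k + u + v modulo `q`, which may exceed `q`. Cancelling one `k` leaves k + u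
  -- + v ≤ q - 1 against w ≤ k - 1, both genuine remainders, which cannot be equal.
  𝓜-sum-free : ∀ {x} → x ∈ 𝓜 k → x ∉ HasOptionIn (𝓜 k) (𝓜 k)
  𝓜-sum-free x∈ (y , (m , m∈ , y+m≡x) , y∈)
    with 𝓜∋ x∈ | 𝓜∋ y∈ | 𝓜∋ m∈
  ... | i , w , w≤n , refl | a , u , u≤n , refl | b , v , v≤n , refl =
    <⇒≱ (s≤s w≤n) (subst (k ≤_) residue (m≤m+n k (u + v)))
    where
    regroupˡ : ∀ k a b q u v → k + ((k + (u + v)) + (a + b) * q) ≡ (a * q + (k + u)) + (b * q + (k + v))
    regroupˡ = solve-∀
    regroupʳ : ∀ k i q w → i * q + (k + w) ≡ k + (w + i * q)
    regroupʳ = solve-∀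

    residue : k + (u + v) ≡ w
    residue = remainder-unique (a + b) i
      (+-monoʳ-< k (s≤s (+-mono-≤ u≤n v≤n)))
      (s≤s (≤-trans w≤n (m≤m+n n (k + n))))
      (+-cancelˡ-≡ k _ _ (trans (regroupˡ k a b q u v) (trans y+m≡x (regroupʳ k i q w))))

  -- A remainder below `k` borrows one period q = k + (2k - 1) and splits off 2k - 1; a remainder of
  -- at least 2k splits off `k`. Only the remainders of `𝓜 k` are left.
  𝓜-sum-covers : ∀ {x} → k ≤ x → x ∉ HasOptionIn (𝓜 k) (𝓜 k) → x ∈ 𝓜 k
  𝓜-sum-covers {x} k≤x x∉ =
    subst (_∈ 𝓜 k) (sym x≡) (covers (x / q) (m%n<n x q)
      (subst (k ≤_) x≡ k≤x) (subst (_∉ HasOptionIn (𝓜 k) (𝓜 k)) x≡ x∉))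
    where
    x≡ : x ≡ x % q + (x / q) * q
    x≡ = m≡m%n+[m/n]*n x q

    -- The summand with `0 * q` keeps the shape given by `∈𝓜 0`, here and in `split-high`.
    split-low : ∀ n t r → let q = suc n + (suc n + n) in
                (t * q + (suc n + r)) + (0 * q + (suc n + n)) ≡ r + suc t * q
    split-low = solve-∀

    split-high : ∀ n t w → let q = suc n + (suc n + n) in
                 (t * q + (suc n + w)) + (0 * q + (suc n + 0)) ≡ suc n + (suc n + w) + t * q
    split-high = solve-∀

    covers : ∀ {r} t → r < q → k ≤ r + t * q →
             r + t * q ∉ HasOptionIn (𝓜 k) (𝓜 k) → r + t * q ∈ 𝓜 k
    covers {r} t r<q k≤ ∉ with k ≤? r
    -- There is no period to borrow, but then the number itself is below `k`.
    covers {r} zero r<q k≤ ∉ | no k≰r = contradiction (subst (k ≤_) (+-identityʳ r) k≤) k≰r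
    covers {r} (suc t) r<q k≤ ∉ | no k≰r =
      ⊥-elim (∉ (_ , (_ , ∈𝓜 0 ≤-refl , split-low n t r) , ∈𝓜 t (s≤s⁻¹ (≰⇒> k≰r))))
    covers t r<q k≤ ∉ | yes k≤r with m≤n⇒∃[o]m+o≡n k≤r
    ... | s , refl with k ≤? s
    ...   | no k≰s = subst (_∈ 𝓜 k) (+-comm (t * q) (k + s)) (∈𝓜 t (s≤s⁻¹ (≰⇒> k≰s)))
    ...   | yes k≤s with m≤n⇒∃[o]m+o≡n k≤s
    ...     | w , refl =
      ⊥-elim (∉ (_ , (_ , ∈𝓜 0 z≤n , split-high n t w) ,
        ∈𝓜 t (<⇒≤ (+-cancelˡ-< k w n (+-cancelˡ-< k (k + w) (k + n) r<q)))))

  𝓜-SelfAvoiding : SelfAvoiding k (𝓜 k)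
  𝓜-SelfAvoiding =
    (λ x∈ → k≤∈𝓜 x∈ , 𝓜-sum-free x∈) , (λ (k≤x , x∉) → 𝓜-sum-covers k≤x x∉)

  IsReflexive-𝓜 : ∀ {M} → M ≐ 𝓜 k → IsReflexive M
  IsReflexive-𝓜 M≐𝓜@(M⊆ , ⊆M) = SelfAvoiding⇒IsReflexive
    (λ 0∈M → n≮0 (k≤∈𝓜 (M⊆ 0∈M)))
    (⊆M (subst (_∈ 𝓜 k) (+-identityʳ k) (∈𝓜 0 z≤n)))
    (k≤∈𝓜 ∘ M⊆)
    (SelfAvoiding-resp-≐ (≐-sym M≐𝓜) 𝓜-SelfAvoiding)

-- Without moves every position is terminal, hence an N-position.
IsReflexive-∅ : ∀ {M} → M ≐ ∅ → IsReflexive M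
IsReflexive-∅ {M} (M⊆∅ , _) =
  (λ {x} (0∉M , ¬N) →
     ⊥-elim (¬N (from (NPosition-⇔ M 0∉M x) (inj₁ λ _ (_ , m∈M , _) → M⊆∅ m∈M)))) ,
  (λ m∈M → ⊥-elim (M⊆∅ m∈M))

IsReflexive⇒0∉ : ∀ {M} → IsReflexive M → 0 ∉ M
IsReflexive⇒0∉ (_ , M⊆P) 0∈M = proj₁ (M⊆P 0∈M) 0∈M

-- `Q` is an arbitrary predicate, so excluded middle decides whether a smaller element exists.
least : ExcludedMiddle 0ℓ → (Q : Pred ℕ 0ℓ) → ∀ m → m ∈ Q →
        ∃[ k ] k ∈ Q × (∀ {x} → x ∈ Q → k ≤ x)
least em Q = <-rec _ λ m ih m∈Q → go m ih m∈Q
  where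
  Least : Set
  Least = ∃[ k ] k ∈ Q × (∀ {x} → x ∈ Q → k ≤ x)

  go : ∀ m → (∀ {y} → y < m → y ∈ Q → Least) → m ∈ Q → Least
  go m ih m∈Q with em {∃[ y ] y < m × y ∈ Q}
  ... | yes (_ , y<m , y∈Q) = ih y<m y∈Q
  ... | no none = m , m∈Q , λ x∈Q → ≮⇒≥ λ x<m → none (_ , x<m , x∈Q)

IsReflexive⇒𝓜 : ExcludedMiddle 0ℓ → ∀ {M} → IsReflexive M → ∃[ k ] M ≐ 𝓜 k
IsReflexive⇒𝓜 em {M} reflexive with em {∃[ m ] m ∈ M}
... | no empty = 0 , (λ m∈M → empty (_ , m∈M)) , λ ()
... | yes (m , m∈M) with least em M m m∈M
...   | zero , 0∈M , _ = contradiction 0∈M (IsReflexive⇒0∉ reflexive)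
...   | suc n , k∈M , k-least =
  suc n , SelfAvoiding-unique
    (IsReflexive⇒SelfAvoiding (IsReflexive⇒0∉ reflexive) k∈M k-least reflexive)
    (𝓜-SelfAvoiding n)

theorem6 : ExcludedMiddle 0ℓ → (M : Game) → IsReflexive M ⇔ (∃[ k ] M ≐ 𝓜 k)
theorem6 em M = mk⇔ (IsReflexive⇒𝓜 em)
  λ { (zero , M≐∅) → IsReflexive-∅ M≐∅ ; (suc n , M≐𝓜) → IsReflexive-𝓜 n M≐𝓜 }
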